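{- Suppose that $\mathcal{A},\mathcal{B}\subseteq\mathbb{N}$. Then for each natural number $N$, one has $$\left(|\mathcal{B}|_0^N\,\left|\overline{\mathcal{A}+\mathcal{B}}\right|_{2N}^{3N}\right)^2\leqslant \left|\overline{\mathcal{A}}\right|_N^{3N}\,\Upsilon\left(\overline{\mathcal{A}+\mathcal{B}},\mathcal{B};N\right).$$
   Context: $\mathbb{N}$ denotes the set of positive integers. For $\mathcal{C}\subseteq\mathbb{N}$, $\overline{\mathcal{C}}=\mathbb{N}\setminus\mathcal{C}$. For non-negative integers $a,b$, $(\mathcal{C})_a^b=\mathcal{C}\cap(a,b]$ and $|\mathcal{C}|_a^b$ is the cardinality of $\mathcal{C}\cap(a,b]$. For $\mathcal{C},\mathcal{D}\subseteq\mathbb{N}$, $\mathcal{C}+\mathcal{D}=\{c+d: c\in\mathcal{C},\ d\in\mathcal{D}\}$. The quantity $\Upsilon(\mathcal{C},\mathcal{D};N)$ is the number of solutions of the equation $c_1-d_1=c_2-d_2$ with $c_1,c_2\in(\mathcal{C})_{2N}^{3N}$ and $d_1,d_2\in(\mathcal{D})_0^N$. -}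

module Defs where

open import Level using (Level; 0ℓ; _⊔_)
open import Data.Integer using (+_; _-_)
open import Data.List using (List; []; _∷_; length; upTo; cartesianProduct)
open import Data.List.Membership.Propositional using () renaming (_∈_ to _∈ₗ_)
open import Data.List.Membership.Propositional.Properties using (∈-upTo⁺; ∈-cartesianProduct⁺)
open import Data.List.Membership.Propositional.Properties.WithK using (unique∧set⇒bag)
open import Data.List.Relation.Binary.BagAndSetEquality using (∼bag⇒↭)
open import Data.List.Relation.Binary.Permutation.Propositional.Properties using (↭-length)
open import Data.List.Relation.Unary.All using (tabulate)
open import Data.List.Relation.Unary.AllPairs using ([]; _∷_)
open import Data.List.Relation.Unary.Any using (here; there)
open import Data.List.Relation.Unary.Unique.Propositional using (Unique)
open import Data.Nat using (ℕ; suc; _+_; _*_; _≤_; _<_; s≤s; _≟_)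
open import Data.Product using (_×_; _,_; ∃; ∃-syntax; proj₁; proj₂)
open import Data.Product.Properties using (≡-dec)
open import Function using (_⇔_; mk⇔; Equivalence; _∘_)
open import Function.Construct.Composition using () renaming (equivalence to ⇔-comp)
open import Function.Construct.Symmetry using (⇔-sym)
open import Relation.Binary.Definitions using (DecidableEquality)
open import Relation.Binary.PropositionalEquality using (_≡_; _≢_; refl; sym; trans)
open import Relation.Nullary using (¬_; Dec; yes; no; contradiction)
open import Relation.Nullary.Decidable using (¬¬-excluded-middle)
open import Relation.Unary using (Pred; _∈_; _⊆_; _∩_; _∖_)

private variable
  a ℓ ℓ₁ ℓ₂ : Level

ℕ₊ : Pred ℕ 0ℓ
ℕ₊ n = 0 < n

-- The complement is taken in ℕ₊, so it never contains 0.
compl : Pred ℕ ℓ → Pred ℕ ℓ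
compl C = ℕ₊ ∖ C

infixl 6 _⊕_

_⊕_ : Pred ℕ ℓ₁ → Pred ℕ ℓ₂ → Pred ℕ (ℓ₁ ⊔ ℓ₂)
(C ⊕ D) n = ∃[ c ] ∃[ d ] c ∈ C × d ∈ D × n ≡ c + d

⟨_,_] : ℕ → ℕ → Pred ℕ 0ℓ
⟨ a , b ] n = a < n × n ≤ b

-- "P has exactly k elements". For a finite P that is not decidable, no number
-- can be computed constructively, so cardinality is a relation rather than a
-- function. It is functional (Card-unique), and a P contained in a list cannot
-- fail to have a cardinality (¬¬Card); classically, it therefore has one.
Card : {A : Set a} → Pred A ℓ → ℕ → Set (a ⊔ ℓ)
Card P k = ∃[ xs ] Unique xs × (∀ x → x ∈ₗ xs ⇔ x ∈ P) × length xs ≡ k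

-- The solutions (c₁ , d₁ , c₂ , d₂) counted by Υ(C, D; N).
-- The subtraction is that of ℤ.
Solutions : Pred ℕ ℓ₁ → Pred ℕ ℓ₂ → ℕ → Pred (ℕ × ℕ × ℕ × ℕ) (ℓ₁ ⊔ ℓ₂)
Solutions C D N (c₁ , d₁ , c₂ , d₂) =
  c₁ ∈ C ∩ ⟨ 2 * N , 3 * N ] × d₁ ∈ D ∩ ⟨ 0 , N ] ×
  c₂ ∈ C ∩ ⟨ 2 * N , 3 * N ] × d₂ ∈ D ∩ ⟨ 0 , N ] ×
  + c₁ - + d₁ ≡ + c₂ - + d₂

-- |C|_a^b = k
SectionCard : Pred ℕ ℓ → ℕ → ℕ → ℕ → Set ℓ
SectionCard C a b = Card (C ∩ ⟨ a , b ])

-- Υ(C, D; N) = k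
Υ : Pred ℕ ℓ₁ → Pred ℕ ℓ₂ → ℕ → ℕ → Set (ℓ₁ ⊔ ℓ₂)
Υ C D N = Card (Solutions C D N)

Card-unique : {A : Set a} {P : Pred A ℓ} {j k : ℕ} → Card P j → Card P k → j ≡ k
Card-unique (xs , uxs , fxs , refl) (ys , uys , fys , refl) =
  ↭-length (∼bag⇒↭ (unique∧set⇒bag uxs uys (λ {x} → ⇔-comp (fxs x) (⇔-sym (fys x)))))

¬¬Card : {A : Set a} → DecidableEquality A → {P : Pred A ℓ} (xs : List A) →
         (∀ {x} → x ∈ P → x ∈ₗ xs) → ¬ ¬ ∃ (Card P)
¬¬Card _≈?_ [] P⊆ none = none (0 , [] , [] , (λ x → mk⇔ (λ ()) P⊆) , refl)
¬¬Card {A = A} _≈?_ {P} (x ∷ xs) P⊆ none =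
  ¬¬Card _≈?_ {Q} xs Q⊆ λ (k , ys , uys , fys , eq) →
  ¬¬-excluded-middle λ where
    (yes px) → none (_ , x ∷ ys
      , tabulate (λ {y} y∈ x≡y → proj₂ (Equivalence.to (fys y) y∈) (sym x≡y)) ∷ uys
      , (λ y → mk⇔ (λ { (here refl) → px ; (there y∈) → proj₁ (Equivalence.to (fys y) y∈) })
                   (λ py → insert py (fys y) (y ≈? x)))
      , refl)
    (no ¬px) → none (_ , ys , uys
      , (λ y → mk⇔ (proj₁ ∘ Equivalence.to (fys y))
                   (λ py → Equivalence.from (fys y) (py , λ { refl → ¬px py })))
      , refl)
  where
  Q : Pred A _
  Q y = P y × y ≢ x

  Q⊆ : ∀ {y} → y ∈ Q → y ∈ₗ xs
  Q⊆ (py , y≢x) with P⊆ py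
  ... | here y≡x = contradiction y≡x y≢x
  ... | there y∈ = y∈

  insert : ∀ {y ys} → P y → y ∈ₗ ys ⇔ Q y → Dec (y ≡ x) → y ∈ₗ x ∷ ys
  insert py f (yes y≡x) = here y≡x
  insert py f (no y≢x)  = there (Equivalence.from f (py , y≢x))

¬¬SectionCard : (C : Pred ℕ ℓ) (a b : ℕ) → ¬ ¬ ∃ (SectionCard C a b)
¬¬SectionCard C a b = ¬¬Card _≟_ (upTo (suc b)) λ (_ , _ , x≤b) → ∈-upTo⁺ (s≤s x≤b)

¬¬Υ : (C : Pred ℕ ℓ₁) (D : Pred ℕ ℓ₂) (N : ℕ) → ¬ ¬ ∃ (Υ C D N)
¬¬Υ C D N = ¬¬Card (≡-dec _≟_ (≡-dec _≟_ (≡-dec _≟_ _≟_)))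
  (cartesianProduct cs (cartesianProduct ds (cartesianProduct cs ds)))
  λ ((_ , _ , c₁≤) , (_ , _ , d₁≤) , (_ , _ , c₂≤) , (_ , _ , d₂≤) , _) →
    ∈-cartesianProduct⁺ (∈-upTo⁺ (s≤s c₁≤)) (∈-cartesianProduct⁺ (∈-upTo⁺ (s≤s d₁≤))
      (∈-cartesianProduct⁺ (∈-upTo⁺ (s≤s c₂≤)) (∈-upTo⁺ (s≤s d₂≤))))
  where
  cs ds : List ℕ
  cs = upTo (suc (3 * N))
  ds = upTo (suc N)

{-# OPTIONS --safe #-}
module Submission where

-- If c lies in the complement of A + B with 2N < c ≤ 3N, and d ∈ B with
-- 0 < d ≤ N, then c - d lies in the complement of A (else c = (c - d) + d ∈ A + B)
-- and N < c - d ≤ 3N. So (c , d) ↦ c - d sends the b·s pairs into a set of size a.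
-- By Cauchy–Schwarz over the fibres, (b·s)² is at most a times the number of
-- colliding pairs of pairs, and that number is Υ.

open import Defs
open import Level using (Level)
open import Data.Integer using (+_; _-_)
open import Data.Integer.Properties as ℤ using (⊖-≥; [+m]-[+n]≡m⊖n)
open import Data.List using (List; []; _∷_; length; map; filter; concatMap; cartesianProduct)
open import Data.List.Membership.Propositional using () renaming (_∈_ to _∈ₗ_)
open import Data.List.Membership.Propositional.Properties
  using (∈-map⁺; ∈-map⁻; ∈-filter⁺; ∈-filter⁻; ∈-concatMap⁺; ∈-concatMap⁻;
         ∈-cartesianProduct⁺; ∈-cartesianProduct⁻)
open import Data.List.Properties using (length-map; length-++; map-cong)
open import Data.List.Relation.Unary.All using (universal)
import Data.List.Relation.Unary.All.Properties as All
open import Data.List.Relation.Unary.AllPairs as AllPairs using ()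
import Data.List.Relation.Unary.AllPairs.Properties as AllPairs
open import Data.List.Relation.Unary.Any as Any using (satisfied)
import Data.List.Relation.Unary.Unique.Propositional.Properties as Unique
open import Data.List.Relation.Unary.Unique.Propositional using (Unique)
open import Data.Nat using (ℕ; suc; _+_; _*_; _∸_; _^_; _≤_; _<_; z≤n)
open import Data.Nat.ListAction using (sum)
open import Data.Nat.Properties hiding (_≟_)
open import Data.Nat.Tactic.RingSolver using (solve-∀)
open import Data.Product using (_×_; _,_; ∃; proj₁; proj₂)
open import Data.Sum using ([_,_]′)
open import Function using (mk⇔; Equivalence; Injective; _∘_)
open import Relation.Binary.Definitions using (DecidableEquality)
open import Relation.Binary.PropositionalEquality using (_≡_; refl; sym; trans; cong; cong₂; subst; subst₂)
open import Relation.Unary using (Pred; Decidable; _∈_; _⊆_; _∩_; _⟨×⟩_)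

private variable
  x y p q : Level
  X : Set x
  Y : Set y

-- To avoid subtracting in ℕ, the smaller number is taken as `m` and the larger written as `m + d`;
-- the two sides then differ by exactly `d * d`.
2mn≤m²+n² : ∀ m n → 2 * (m * n) ≤ m * m + n * n
2mn≤m²+n² m n = [ ordered , (λ n≤m →
  subst₂ _≤_ (cong (2 *_) (*-comm n m)) (+-comm (n * n) (m * m)) (ordered n≤m)) ]′ (≤-total m n)
  where
  complete-square : ∀ m d → 2 * (m * (m + d)) + d * d ≡ m * m + (m + d) * (m + d)
  complete-square = solve-∀

  ordered : ∀ {m n} → m ≤ n → 2 * (m * n) ≤ m * m + n * n
  ordered {m} {n} m≤n = subst (λ n → 2 * (m * n) ≤ m * m + n * n) (m+[n∸m]≡n m≤n)
    (m+n≤o⇒m≤o _ (≤-reflexive (complete-square m (n ∸ m))))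

-- Applies `2mn≤m²+n²` to `r` and each `k x` and adds up. This controls the cross term that appears
-- when a summand `r` joins the sum in Cauchy-Schwarz.
2*r*sum≤length*r²+sum² : (k : X → ℕ) (r : ℕ) (xs : List X) →
  2 * (r * sum (map k xs)) ≤ length xs * (r * r) + sum (map (λ x → k x * k x) xs)
2*r*sum≤length*r²+sum² k r []       = ≤-reflexive (cong (2 *_) (*-zeroʳ r))
2*r*sum≤length*r²+sum² k r (x ∷ xs) = begin
  2 * (r * (k x + t))                     ≡⟨ split r (k x) t ⟩
  2 * (r * k x) + 2 * (r * t)             ≤⟨ +-mono-≤ (2mn≤m²+n² r (k x)) (2*r*sum≤length*r²+sum² k r xs) ⟩
  r * r + k x * k x + (l * (r * r) + e)   ≡⟨ regroup (r * r) (k x * k x) (l * (r * r)) e ⟩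
  r * r + l * (r * r) + (k x * k x + e)   ∎
  where
  open ≤-Reasoning
  l = length xs
  t = sum (map k xs)
  e = sum (map (λ x → k x * k x) xs)
  split : ∀ r s t → 2 * (r * (s + t)) ≡ 2 * (r * s) + 2 * (r * t)
  split = solve-∀
  regroup : ∀ a b c d → a + b + (c + d) ≡ a + c + (b + d)
  regroup = solve-∀

-- Induction on the list: expand the square of head plus tail, bound the cross term by the previous
-- lemma and the square of the tail by the induction hypothesis; the bounds add up to exactly the
-- required product.
cauchy-schwarz : (k : X → ℕ) (xs : List X) →
  sum (map k xs) ^ 2 ≤ length xs * sum (map (λ x → k x * k x) xs)
cauchy-schwarz k []       = z≤n
cauchy-schwarz k (x ∷ xs) = begin
  (r + t) ^ 2                                  ≡⟨ expand r t ⟩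
  r * r + 2 * (r * t) + t ^ 2                  ≤⟨ +-mono-≤ (+-monoʳ-≤ (r * r) (2*r*sum≤length*r²+sum² k r xs)) (cauchy-schwarz k xs) ⟩
  r * r + (l * (r * r) + e) + l * e            ≡⟨ collect (r * r) l e ⟩
  suc l * (r * r + e)                          ∎
  where
  open ≤-Reasoning
  r = k x
  l = length xs
  t = sum (map k xs)
  e = sum (map (λ x → k x * k x) xs)
  -- The factors `* 1` match the unfolding of `_^ 2`.
  expand : ∀ r t → (r + t) * ((r + t) * 1) ≡ r * r + 2 * (r * t) + t * (t * 1)
  expand = solve-∀
  collect : ∀ a l e → a + (l * a + e) + l * e ≡ (1 + l) * (a + e)
  collect = solve-∀

length-concatMap : (f : X → List Y) (xs : List X) →
  length (concatMap f xs) ≡ sum (map (length ∘ f) xs)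
length-concatMap f []       = refl
length-concatMap f (x ∷ xs) = trans (length-++ (f x)) (cong (λ n → length (f x) + n) (length-concatMap f xs))

length-cartesianProduct : (xs : List X) (ys : List Y) →
  length (cartesianProduct xs ys) ≡ length xs * length ys
length-cartesianProduct []       ys = refl
length-cartesianProduct (x ∷ xs) ys = trans (length-++ (map (x ,_) ys))
  (cong₂ _+_ (length-map (x ,_) ys) (length-cartesianProduct xs ys))

Card-⟨×⟩ : {P : Pred X p} {Q : Pred Y q} {j k : ℕ} →
  Card P j → Card Q k → Card (P ⟨×⟩ Q) (j * k)
Card-⟨×⟩ (xs , uxs , fxs , refl) (ys , uys , fys , refl) =
  cartesianProduct xs ys , Unique.cartesianProduct⁺ uxs uys ,
  (λ (x , y) → mk⇔
    (λ ∈xys → let x∈ , y∈ = ∈-cartesianProduct⁻ xs ys ∈xys in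
      Equivalence.to (fxs x) x∈ , Equivalence.to (fys y) y∈)
    (λ (px , qy) → ∈-cartesianProduct⁺ (Equivalence.from (fxs x) px) (Equivalence.from (fys y) qy))) ,
  length-cartesianProduct xs ys

-- `P` need not be decidable: its enumeration is already given, and filtering it only requires
-- deciding `Q`.
Card-∩ : {P : Pred X p} {Q : Pred X q} {k : ℕ} →
  Decidable Q → Card P k → ∃ (Card (P ∩ Q))
Card-∩ Q? (xs , uxs , fxs , _) =
  _ , filter Q? xs , Unique.filter⁺ Q? uxs ,
  (λ x → mk⇔
    (λ x∈ → let x∈xs , qx = ∈-filter⁻ Q? x∈ in Equivalence.to (fxs x) x∈xs , qx)
    (λ (px , qx) → ∈-filter⁺ Q? (Equivalence.from (fxs x) px) qx)) ,
  refl

Card-map : {P : Pred X p} {Q : Pred Y q} {k : ℕ} (g : X → Y) → Injective _≡_ _≡_ g →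
  (∀ {x} → x ∈ P → g x ∈ Q) → (∀ {y} → y ∈ Q → ∃ λ x → x ∈ P × y ≡ g x) →
  Card P k → Card Q k
Card-map {Q = Q} g g-injective image preimage (xs , uxs , fxs , refl) =
  map g xs , Unique.map⁺ g-injective uxs ,
  (λ y → mk⇔
    (λ y∈ → let x , x∈ , y≡gx = ∈-map⁻ g y∈ in
      subst Q (sym y≡gx) (image (Equivalence.to (fxs x) x∈)))
    (λ qy → let x , px , y≡gx = preimage qy in
      subst (_∈ₗ map g xs) (sym y≡gx) (∈-map⁺ g (Equivalence.from (fxs x) px)))) ,
  length-map g xs

-- Fibres over distinct values are disjoint, so concatenating their enumerations creates no
-- repetition. The list `ys` may exceed the image of `P`, since empty fibres contribute 0.
Card-partition : {P : Pred X p} (f : X → Y) (k : Y → ℕ) {ys : List Y} → Unique ys →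
  (∀ {x} → x ∈ P → f x ∈ₗ ys) → (∀ y → Card (P ∩ (λ x → f x ≡ y)) (k y)) →
  Card P (sum (map k ys))
Card-partition {P = P} f k {ys} uys fx∈ys fibres =
  concatMap fibre ys ,
  Unique.concat⁺ (All.map⁺ (universal (λ y → proj₁ (proj₂ (fibres y))) ys))
    (AllPairs.map⁺ (AllPairs.map
      (λ y≢z {_} (x∈y , x∈z) →
        y≢z (trans (sym (proj₂ (∈-fibre⁻ x∈y))) (proj₂ (∈-fibre⁻ x∈z)))) uys)) ,
  (λ x → mk⇔
    (λ x∈ → proj₁ (∈-fibre⁻ (proj₂ (satisfied (∈-concatMap⁻ fibre {xs = ys} x∈)))))
    (λ px → ∈-concatMap⁺ fibre (Any.map (λ fx≡y → ∈-fibre⁺ (px , fx≡y)) (fx∈ys px)))) ,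
  trans (length-concatMap fibre ys) (cong sum (map-cong length-fibre ys))
  where
  fibre = λ y → proj₁ (fibres y)

  ∈-fibre⁻ : ∀ {x y} → x ∈ₗ fibre y → x ∈ P × f x ≡ y
  ∈-fibre⁻ {x} {y} = let _ , _ , ffib , _ = fibres y in Equivalence.to (ffib x)

  ∈-fibre⁺ : ∀ {x y} → x ∈ P × f x ≡ y → x ∈ₗ fibre y
  ∈-fibre⁺ {x} {y} = let _ , _ , ffib , _ = fibres y in Equivalence.from (ffib x)

  length-fibre : ∀ y → length (fibre y) ≡ k y
  length-fibre y = proj₂ (proj₂ (proj₂ (fibres y)))

-- With `k y` the size of the fibre over `y`, `n` is the sum of `k y` and `e` the sum of
-- `k y * k y`, so Cauchy-Schwarz over `ys` applies.
Card-collisions : {P : Pred X p} {n e : ℕ} → DecidableEquality Y →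
  (f : X → Y) {ys : List Y} → Unique ys →
  (∀ {x} → x ∈ P → f x ∈ₗ ys) → Card P n →
  Card (λ (v , w) → v ∈ P × w ∈ P × f v ≡ f w) e → n ^ 2 ≤ length ys * e
Card-collisions {P = P} _≟_ f {ys} uys fx∈ys card-P card-E =
  subst₂ (λ n e → n ^ 2 ≤ length ys * e)
    (Card-unique (Card-partition f k uys fx∈ys card-fibre) card-P)
    (Card-unique (Card-partition (f ∘ proj₁) (λ y → k y * k y) uys (fx∈ys ∘ proj₁) card-fibre²) card-E)
    (cauchy-schwarz k ys)
  where
  k : _ → ℕ
  k y = proj₁ (Card-∩ (λ x → f x ≟ y) card-P)

  card-fibre : ∀ y → Card (P ∩ (λ x → f x ≡ y)) (k y)
  card-fibre y = proj₂ (Card-∩ (λ x → f x ≟ y) card-P)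

  -- A colliding pair whose first entry maps to `y` has both entries in the fibre over `y`, so these
  -- pairs form the square of that fibre.
  card-fibre² : ∀ y →
    Card ((λ (v , w) → v ∈ P × w ∈ P × f v ≡ f w) ∩ (λ (v , w) → f v ≡ y)) (k y * k y)
  card-fibre² y = Card-map (λ z → z) (λ eq → eq)
    (λ ((pv , fv≡y) , (pw , fw≡y)) → (pv , pw , trans fv≡y (sym fw≡y)) , fv≡y)
    (λ {z} ((pv , pw , fv≡fw) , fv≡y) → z , ((pv , fv≡y) , (pw , trans (sym fv≡fw) fv≡y)) , refl)
    (Card-⟨×⟩ (card-fibre y) (card-fibre y))

-- Since `N + d ≤ 2 * N < c`, the truncated `c ∸ d` is a true difference exceeding `N`; the equation
-- ties it to the ℤ-subtraction in `Solutions`.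
difference-∈-compl : {A : Pred ℕ p} {B : Pred ℕ q} {N c d : ℕ} →
  c ∈ compl (A ⊕ B) ∩ ⟨ 2 * N , 3 * N ] → d ∈ B ∩ ⟨ 0 , N ] →
  c ∸ d ∈ compl A ∩ ⟨ N , 3 * N ] × + c - + d ≡ + (c ∸ d)
difference-∈-compl {N = N} {c} {d} ((0<c , c∉A⊕B) , 2N<c , c≤3N) (d∈B , 0<d , d≤N) =
  ((≤-<-trans z≤n N<c∸d ,
    λ c∸d∈A → c∉A⊕B (c ∸ d , d , c∸d∈A , d∈B , sym (m∸n+n≡m d≤c))) ,
   N<c∸d , ≤-trans (m∸n≤m c d) c≤3N) ,
  trans ([+m]-[+n]≡m⊖n c d) (⊖-≥ d≤c)
  where
  N+d<c : N + d < c
  -- `2 * N` unfolds to `N + (N + 0)`, hence the use of `+-identityʳ`.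
  N+d<c = ≤-<-trans (+-monoʳ-≤ N (≤-trans d≤N (≤-reflexive (sym (+-identityʳ N))))) 2N<c
  N<c∸d : N < c ∸ d
  N<c∸d = m+n≤o⇒m≤o∸n (suc N) N+d<c
  d≤c : d ≤ c
  d≤c = ≤-trans (m≤n+m d N) (<⇒≤ N+d<c)

theorem1p1 : ∀ {ℓ₁ ℓ₂ : Level} (A : Pred ℕ ℓ₁) (B : Pred ℕ ℓ₂) →
    A ⊆ ℕ₊ → B ⊆ ℕ₊ →
    ∀ (N : ℕ) → N ∈ ℕ₊ →
    ∀ {b s a u : ℕ} →
    SectionCard B 0 N b →
    SectionCard (compl (A ⊕ B)) (2 * N) (3 * N) s →
    SectionCard (compl A) N (3 * N) a →
    Υ (compl (A ⊕ B)) B N u →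
    (b * s) ^ 2 ≤ a * u
theorem1p1 A B _ _ N _ {b} {s} {a} {u} card-B card-S (as , uas , fas , refl) card-Υ =
  -- Differences are taken in ℤ, so the list of possible values is `map +_ as`, as long as `as`; the
  -- pairs `(c , d)` are counted as `s * b`.
  subst₂ (λ n l → n ^ 2 ≤ l * u) (*-comm s b) (length-map +_ as)
    (Card-collisions ℤ._≟_ (λ (c , d) → + c - + d)
      (Unique.map⁺ ℤ.+-injective uas)
      (λ {(c , d)} (c∈ , d∈) →
        let c∸d∈ , eq = difference-∈-compl c∈ d∈ in
        subst (_∈ₗ map +_ as) (sym eq) (∈-map⁺ +_ (Equivalence.from (fas (c ∸ d)) c∸d∈)))
      (Card-⟨×⟩ card-S card-B)
      -- Rebracketing a quadruple as two pairs turns the solutions counted by `Υ` into collisions of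
      -- the difference map.
      (Card-map (λ (c₁ , d₁ , c₂ , d₂) → (c₁ , d₁) , (c₂ , d₂)) (λ { refl → refl })
        (λ (c₁∈ , d₁∈ , c₂∈ , d₂∈ , eq) → (c₁∈ , d₁∈) , (c₂∈ , d₂∈) , eq)
        (λ { {(c₁ , d₁) , (c₂ , d₂)} ((c₁∈ , d₁∈) , (c₂∈ , d₂∈) , eq) →
          (c₁ , d₁ , c₂ , d₂) , (c₁∈ , d₁∈ , c₂∈ , d₂∈ , eq) , refl })
        card-Υ))
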